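{- For every integer $n\geq2$, $$p(n)=n\cdot\nu(n)-\sum_{k=3}^{n}(k-1)\gamma(k),$$ where the sum is empty (equal to $0$) if $n=2$.
   Context: $p(n)$ is the number of integer partitions of $n$. A nuclear partition is an integer partition with no part equal to $1$, and $\nu(n)$ is the number of nuclear partitions of $n$. $\gamma(n)$ denotes the number of nuclear partitions $\mu=(\mu_1,\mu_2,\dots,\mu_r)$ of $n$, with $\mu_1\geq\mu_2\geq\dots\geq\mu_r\geq2$ and $r\geq2$, such that $\mu_1=\mu_2$ (so the two largest parts are equal). -}

module Defs where

open import Data.Nat using (ℕ; zero; suc; _+_; _<_; _≥_; _∸_; s≤s; _≟_; _≥?_; _<?_)
open import Data.Nat.Properties
  using (+-suc; +-identityʳ; suc-injective; ≤-refl; <⇒≤; <-irrefl)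
open import Data.Integer as ℤ using (ℤ; 0ℤ)
open import Data.List using (List; []; _∷_; [_]; _++_; map; foldr; filter; length; upTo)
open import Data.Nat.ListAction using (sum)
open import Data.List.Properties using (∷-injectiveˡ; ∷-injectiveʳ)
open import Data.List.Membership.Propositional using (_∈_; _∉_)
open import Data.List.Membership.Propositional.Properties
  using (∈-map⁺; ∈-map⁻; ∈-++⁺ˡ; ∈-++⁺ʳ; ∈-++⁻; ∈-filter⁺; ∈-filter⁻)
import Data.List.Membership.DecPropositional as DecMembership
open import Data.List.Relation.Unary.All as All using (All; []; _∷_)
open import Data.List.Relation.Unary.AllPairs using ([]; _∷_)
open import Data.List.Relation.Unary.Any using (here; there)
open import Data.List.Relation.Unary.Linked using (Linked; linked?)
open import Data.List.Relation.Unary.Unique.Propositional using (Unique)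
import Data.List.Relation.Unary.Unique.Propositional.Properties as Unique
open import Data.Product using (∃₂; _×_; _,_; proj₂)
open import Data.Sum using (inj₁; inj₂)
open import Function using (_⇔_; mk⇔)
open import Relation.Binary.PropositionalEquality using (_≡_; refl)
open import Relation.Nullary using (no)
open import Relation.Nullary.Decidable using (map′; ¬?; _×-dec_)
open import Relation.Unary using (Decidable)

record IsPartition (n : ℕ) (μ : List ℕ) : Set where
  constructor isPartition
  field
    weaklyDecreasing : Linked _≥_ μ
    positive         : All (0 <_) μ
    sums             : sum μ ≡ n

isPartition? : ∀ n → Decidable (IsPartition n)
isPartition? n μ =
  map′ (λ (d , p , s) → isPartition d p s)
       (λ (isPartition d p s) → d , p , s)
       (linked? _≥?_ μ ×-dec All.all? (0 <?_) μ ×-dec (sum μ ≟ n))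

-- compositionsFrom k m lists the finite sequences of positive integers with
-- sum 1 + k + m whose first term is at least 1 + k.
compositionsFrom : ℕ → ℕ → List (List ℕ)
compositionsFrom k zero    = [ [ suc k ] ]
compositionsFrom k (suc m) =
  map (suc k ∷_) (compositionsFrom 0 m) ++ compositionsFrom (suc k) m

compositions : ℕ → List (List ℕ)
compositions zero    = [ [] ]
compositions (suc n) = compositionsFrom 0 n

-- Each partition of n occurs exactly once: see ∈-partitions and
-- partitions-unique below.
partitions : ℕ → List (List ℕ)
partitions n = filter (isPartition? n) (compositions n)

Nuclear : List ℕ → Set
Nuclear μ = 1 ∉ μ

nuclear? : Decidable Nuclear
nuclear? μ = ¬? (1 ∈? μ)
  where open DecMembership _≟_ using (_∈?_)

-- The partition has at least two parts and its first two parts, which are its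
-- largest, are equal.
data TopTwoEqual : List ℕ → Set where
  topTwoEqual : ∀ {a b μ} → a ≡ b → TopTwoEqual (a ∷ b ∷ μ)

topTwoEqual? : Decidable TopTwoEqual
topTwoEqual? []          = no λ ()
topTwoEqual? (_ ∷ [])    = no λ ()
topTwoEqual? (a ∷ b ∷ μ) = map′ topTwoEqual (λ { (topTwoEqual e) → e }) (a ≟ b)

p : ℕ → ℕ
p n = length (partitions n)

ν : ℕ → ℕ
ν n = length (filter nuclear? (partitions n))

γ : ℕ → ℕ
γ n = length (filter (λ μ → nuclear? μ ×-dec topTwoEqual? μ) (partitions n))

-- f a + f (a + 1) + ⋯ + f b, which is 0 when b < a.
sumFromTo : ℕ → ℕ → (ℕ → ℤ) → ℤ
sumFromTo a b f = foldr ℤ._+_ 0ℤ (map (λ i → f (a + i)) (upTo (suc b ∸ a)))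

private
  compositionsFrom-head : ∀ k m {μ} → μ ∈ compositionsFrom k m →
                          ∃₂ λ a ρ → μ ≡ a ∷ ρ × k < a
  compositionsFrom-head k zero    (here refl) = _ , _ , refl , ≤-refl
  compositionsFrom-head k (suc m) μ∈
    with ∈-++⁻ (map (suc k ∷_) (compositionsFrom 0 m)) μ∈
  ... | inj₁ l with ∈-map⁻ (suc k ∷_) l
  ...   | _ , _ , refl = _ , _ , refl , ≤-refl
  compositionsFrom-head k (suc m) μ∈ | inj₂ r
    with compositionsFrom-head (suc k) m r
  ... | a , ρ , e , 1+k<a = a , ρ , e , <⇒≤ 1+k<a

  compositionsFrom-unique : ∀ k m → Unique (compositionsFrom k m)
  compositionsFrom-unique k zero    = [] ∷ []
  compositionsFrom-unique k (suc m) =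
    Unique.++⁺ (Unique.map⁺ ∷-injectiveʳ (compositionsFrom-unique 0 m))
               (compositionsFrom-unique (suc k) m)
               λ (l , r) → disjoint l r
    where
    disjoint : ∀ {μ} → μ ∈ map (suc k ∷_) (compositionsFrom 0 m) →
               μ ∈ compositionsFrom (suc k) m → _
    disjoint l r with ∈-map⁻ (suc k ∷_) l | compositionsFrom-head (suc k) m r
    ... | _ , _ , refl | _ , _ , e , 1+k<a = <-irrefl (∷-injectiveˡ e) 1+k<a

  sum≡0 : ∀ {ρ} → All (0 <_) ρ → sum ρ ≡ 0 → ρ ≡ []
  sum≡0 []           _  = refl
  sum≡0 (s≤s _ ∷ _) ()

  -- The head of the sequence is 1 + (k + d).
  compositionsFrom-complete :
    ∀ k m d {ρ} → All (0 <_) ρ → d + sum ρ ≡ m →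
    suc (k + d) ∷ ρ ∈ compositionsFrom k m
  compositionsFrom-complete k zero zero ρ>0 e
    rewrite sum≡0 ρ>0 e | +-identityʳ k = here refl
  compositionsFrom-complete k (suc m) zero {suc b ∷ ρ} (_ ∷ ρ>0) e
    rewrite +-identityʳ k =
    ∈-++⁺ˡ (∈-map⁺ (suc k ∷_)
      (compositionsFrom-complete 0 m b ρ>0 (suc-injective e)))
  compositionsFrom-complete k (suc m) (suc d) ρ>0 e
    rewrite +-suc k d =
    ∈-++⁺ʳ (map (suc k ∷_) (compositionsFrom 0 m))
      (compositionsFrom-complete (suc k) m d ρ>0 (suc-injective e))

  compositions-complete : ∀ n {μ} → All (0 <_) μ → sum μ ≡ n → μ ∈ compositions n
  compositions-complete zero    μ>0 e rewrite sum≡0 μ>0 e = here refl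
  compositions-complete (suc n) {suc a ∷ μ} (_ ∷ μ>0) e =
    compositionsFrom-complete 0 n a μ>0 (suc-injective e)

  compositions-unique : ∀ n → Unique (compositions n)
  compositions-unique zero    = [] ∷ []
  compositions-unique (suc n) = compositionsFrom-unique 0 n

∈-partitions : ∀ n μ → μ ∈ partitions n ⇔ IsPartition n μ
∈-partitions n μ = mk⇔
  (λ μ∈ → proj₂ (∈-filter⁻ (isPartition? n) {xs = compositions n} μ∈))
  (λ h → ∈-filter⁺ (isPartition? n)
           (compositions-complete n (IsPartition.positive h) (IsPartition.sums h)) h)

partitions-unique : ∀ n → Unique (partitions n)
partitions-unique n = Unique.filter⁺ (isPartition? n) (compositions-unique n)

{-# OPTIONS --safe #-}

-- Deleting a part 1 matches the non-nuclear partitions of n + 1 with the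
-- partitions of n, so p (n + 1) = ν (n + 1) + p n.  Decrementing the largest
-- part matches the nuclear partitions of n + 1 whose two largest parts are not
-- equal with the nuclear partitions of n, so ν (n + 1) = γ (n + 1) + ν n
-- for n ≥ 2.  Given these recurrences the formula follows by induction from
-- p 2 = 2 = 2 ν 2.
module Submission where

open import Defs
open import Data.Nat using (ℕ; _≤_)
open import Data.Integer using (+_; _-_; _*_; 1ℤ)
open import Relation.Binary.PropositionalEquality using (_≡_)

open import Data.Nat as ℕ using (zero; suc; s≤s; z≤n; _<_; _≥_; _∸_; _≟_)
import Data.Nat.Properties as ℕ
open import Data.Nat.ListAction using (sum)
open import Data.Nat.ListAction.Properties using (sum-++)
open import Data.Integer as ℤ using (ℤ; 0ℤ)
import Data.Integer.Properties as ℤ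
open import Data.Integer.Tactic.RingSolver using (solve-∀)
open import Data.List using (List; []; _∷_; _++_; _∷ʳ_; map; foldr; filter; length; upTo)
open import Data.List.Properties
  using (map-++; foldr-∷ʳ; upTo-∷ʳ; length-++; length-map; ∷ʳ-injectiveˡ)
open import Data.List.Membership.Propositional using (_∈_)
open import Data.List.Membership.Propositional.Properties
  using (∈-map⁺; ∈-map⁻; ∈-++⁺ˡ; ∈-++⁺ʳ; ∈-++⁻; ∈-filter⁺; ∈-filter⁻)
open import Data.List.Membership.Propositional.Properties.WithK using (unique∧set⇒bag)
open import Data.List.Relation.Binary.BagAndSetEquality using (∼bag⇒↭)
open import Data.List.Relation.Binary.Permutation.Propositional.Properties using (↭-length)
open import Data.List.Relation.Unary.All using (All; []; _∷_)
import Data.List.Relation.Unary.All.Properties as All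
open import Data.List.Relation.Unary.Any using (here; there)
open import Data.List.Relation.Unary.Linked using (Linked; []; [-]; _∷_)
open import Data.List.Relation.Unary.Unique.Propositional using (Unique)
import Data.List.Relation.Unary.Unique.Propositional.Properties as Unique
open import Data.Product using (∃; _×_; _,_; proj₁)
open import Data.Sum using (inj₁; inj₂)
open import Function using (mk⇔; Equivalence)
open import Relation.Binary.PropositionalEquality
  using (refl; sym; trans; cong; cong₂; module ≡-Reasoning)
open import Relation.Nullary using (¬_; yes; no; contradiction)
open import Relation.Nullary.Decidable using (_×-dec_; decidable-stable)
open import Relation.Unary using (Decidable)

-- The last two hypotheses say that `f` maps `ys` onto the members of `xs` that fail `P`. So `xs`
-- and `filter P? xs ++ map f ys` are duplicate-free with the same members, hence permutations of
-- each other. Both recurrences are instances.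
length-filter-bijection :
  ∀ {A B : Set} {P : A → Set} (P? : Decidable P) (f : B → A) →
  (∀ {x y} → f x ≡ f y → x ≡ y) →
  ∀ {xs ys} → Unique xs → Unique ys →
  (∀ {y} → y ∈ ys → f y ∈ xs × ¬ P (f y)) →
  (∀ {x} → x ∈ xs → ¬ P x → ∃ λ y → y ∈ ys × x ≡ f y) →
  length xs ≡ length (filter P? xs) ℕ.+ length ys
length-filter-bijection P? f f-inj {xs} {ys} xs! ys! fwd bwd = begin
  length xs                                      ≡⟨ ↭-length (∼bag⇒↭ (unique∧set⇒bag xs! rhs! (mk⇔ to from))) ⟩
  length (filter P? xs ++ map f ys)              ≡⟨ length-++ (filter P? xs) ⟩
  length (filter P? xs) ℕ.+ length (map f ys)    ≡⟨ cong (length (filter P? xs) ℕ.+_) (length-map f ys) ⟩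
  length (filter P? xs) ℕ.+ length ys            ∎
  where
  open ≡-Reasoning

  rhs! : Unique (filter P? xs ++ map f ys)
  rhs! = Unique.++⁺ (Unique.filter⁺ P? xs!) (Unique.map⁺ f-inj ys!) disjoint
    where
    disjoint : ∀ {x} → ¬ (x ∈ filter P? xs × x ∈ map f ys)
    disjoint (l , r) with ∈-filter⁻ P? {xs = xs} l | ∈-map⁻ f r
    ... | _ , px | _ , y∈ys , refl with fwd y∈ys
    ...   | _ , ¬px = ¬px px

  to : ∀ {x} → x ∈ xs → x ∈ filter P? xs ++ map f ys
  to {x} x∈xs with P? x
  ... | yes px = ∈-++⁺ˡ (∈-filter⁺ P? x∈xs px)
  ... | no ¬px with bwd x∈xs ¬px
  ...   | _ , y∈ys , refl = ∈-++⁺ʳ (filter P? xs) (∈-map⁺ f y∈ys)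

  from : ∀ {x} → x ∈ filter P? xs ++ map f ys → x ∈ xs
  from x∈ with ∈-++⁻ (filter P? xs) x∈
  ... | inj₁ l = proj₁ (∈-filter⁻ P? {xs = xs} l)
  ... | inj₂ r with ∈-map⁻ f r
  ...   | _ , y∈ys , refl = proj₁ (fwd y∈ys)

filter-×-dec :
  ∀ {A : Set} {P Q : A → Set} (P? : Decidable P) (Q? : Decidable Q) xs →
  filter (λ x → P? x ×-dec Q? x) xs ≡ filter Q? (filter P? xs)
filter-×-dec P? Q? [] = refl
filter-×-dec P? Q? (x ∷ xs) with P? x
... | no  _ = filter-×-dec P? Q? xs
... | yes _ with Q? x
...   | no  _ = filter-×-dec P? Q? xs
...   | yes _ = cong (x ∷_) (filter-×-dec P? Q? xs)

∈-partitions⁺ : ∀ n {μ} → IsPartition n μ → μ ∈ partitions n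
∈-partitions⁺ n {μ} = Equivalence.from (∈-partitions n μ)

∈-partitions⁻ : ∀ n {μ} → μ ∈ partitions n → IsPartition n μ
∈-partitions⁻ n {μ} = Equivalence.to (∈-partitions n μ)

sum-∷ʳ1 : ∀ ρ → sum (ρ ∷ʳ 1) ≡ suc (sum ρ)
sum-∷ʳ1 ρ = trans (sum-++ ρ _) (ℕ.+-comm (sum ρ) 1)

decreasing-∷ʳ1 : ∀ {ρ} → Linked _≥_ ρ → All (0 <_) ρ → Linked _≥_ (ρ ∷ʳ 1)
decreasing-∷ʳ1 []           _          = [-]
decreasing-∷ʳ1 [-]          (x>0 ∷ _)  = x>0 ∷ [-]
decreasing-∷ʳ1 (x≥y ∷ y∷ρ≥) (_ ∷ y∷ρ>0) = x≥y ∷ decreasing-∷ʳ1 y∷ρ≥ y∷ρ>0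

Linked-∷ʳ⁻ : ∀ {A : Set} {R : A → A → Set} ρ {x} → Linked R (ρ ∷ʳ x) → Linked R ρ
Linked-∷ʳ⁻ []          _         = []
Linked-∷ʳ⁻ (_ ∷ [])    _         = [-]
Linked-∷ʳ⁻ (_ ∷ y ∷ ρ) (Rxy ∷ l) = Rxy ∷ Linked-∷ʳ⁻ (y ∷ ρ) l

-- Parts are positive and weakly decreasing, so only 1s can follow a 1. The search for the final 1
-- can therefore always pass to the tail.
∈-1⇒∷ʳ1 : ∀ {μ} → Linked _≥_ μ → All (0 <_) μ → 1 ∈ μ → ∃ λ ρ → μ ≡ ρ ∷ʳ 1
∈-1⇒∷ʳ1 [-] _ (here refl) = [] , refl
∈-1⇒∷ʳ1 {x ∷ y ∷ μ} (x≥y ∷ l) (_ ∷ y∷μ>0@(y>0 ∷ _)) 1∈ =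
  let ρ , e = ∈-1⇒∷ʳ1 l y∷μ>0 (1∈tail 1∈) in x ∷ ρ , cong (x ∷_) e
  where
  1∈tail : 1 ∈ x ∷ y ∷ μ → 1 ∈ y ∷ μ
  1∈tail (here refl)  = here (ℕ.≤-antisym y>0 x≥y)
  1∈tail (there 1∈tl) = 1∈tl

isPartition-∷ʳ1⁺ : ∀ {n ρ} → IsPartition n ρ → IsPartition (suc n) (ρ ∷ʳ 1)
isPartition-∷ʳ1⁺ {ρ = ρ} (isPartition d p s) = isPartition
  (decreasing-∷ʳ1 d p)
  (All.∷ʳ⁺ p (s≤s z≤n))
  (trans (sum-∷ʳ1 ρ) (cong suc s))

isPartition-∷ʳ1⁻ : ∀ {n} ρ → IsPartition (suc n) (ρ ∷ʳ 1) → IsPartition n ρ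
isPartition-∷ʳ1⁻ ρ (isPartition d p s) = isPartition
  (Linked-∷ʳ⁻ ρ d)
  (proj₁ (All.∷ʳ⁻ p))
  (ℕ.suc-injective (trans (sym (sum-∷ʳ1 ρ)) s))

p-suc : ∀ n → p (suc n) ≡ ν (suc n) ℕ.+ p n
p-suc n = length-filter-bijection nuclear? (_∷ʳ 1) (∷ʳ-injectiveˡ _ _)
  (partitions-unique (suc n)) (partitions-unique n)
  (λ {ρ} ρ∈ → ∈-partitions⁺ (suc n) (isPartition-∷ʳ1⁺ (∈-partitions⁻ n ρ∈))
            , λ 1∉ → 1∉ (∈-++⁺ʳ ρ (here refl)))
  backward
  where
  open import Data.List.Membership.DecPropositional _≟_ using (_∈?_)

  backward : ∀ {μ} → μ ∈ partitions (suc n) → ¬ Nuclear μ →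
             ∃ λ ρ → ρ ∈ partitions n × μ ≡ ρ ∷ʳ 1
  backward {μ} μ∈ ¬nuc with ∈-partitions⁻ (suc n) μ∈
  -- Failing `Nuclear` is only a double negation of `1 ∈ μ`; decidability of membership removes it.
  ... | h@(isPartition d p _) with ∈-1⇒∷ʳ1 d p (decidable-stable (1 ∈? μ) ¬nuc)
  ...   | ρ , refl = ρ , ∈-partitions⁺ n (isPartition-∷ʳ1⁻ ρ h) , refl

nuclearPartitions : ℕ → List (List ℕ)
nuclearPartitions n = filter nuclear? (partitions n)

nuclearPartitions-unique : ∀ n → Unique (nuclearPartitions n)
nuclearPartitions-unique n = Unique.filter⁺ nuclear? (partitions-unique n)

∈-nuclearPartitions⁺ : ∀ n {μ} → IsPartition n μ → Nuclear μ → μ ∈ nuclearPartitions n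
∈-nuclearPartitions⁺ n h = ∈-filter⁺ nuclear? (∈-partitions⁺ n h)

∈-nuclearPartitions⁻ : ∀ n {μ} → μ ∈ nuclearPartitions n → IsPartition n μ × Nuclear μ
∈-nuclearPartitions⁻ n μ∈ with ∈-filter⁻ nuclear? {xs = partitions n} μ∈
... | μ∈p , nuc = ∈-partitions⁻ n μ∈p , nuc

-- The bijection is taken in the incrementing direction because this map is injective on all lists,
-- whereas truncated decrementing would identify heads 0 and 1. Sending `[]` to itself preserves
-- injectivity.
incrementHead : List ℕ → List ℕ
incrementHead []      = []
incrementHead (a ∷ μ) = suc a ∷ μ

incrementHead-injective : ∀ {μ ρ} → incrementHead μ ≡ incrementHead ρ → μ ≡ ρ
incrementHead-injective {[]}    {[]}    refl = refl
incrementHead-injective {_ ∷ _} {_ ∷ _} refl = refl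

-- The bound is sharp: for `n = 1` the partition (2) would decrement to (1), which is not nuclear,
-- and for `n = 0` the empty partition has no part to increment.
ν-suc : ∀ n → 2 ≤ n → ν (suc n) ≡ γ (suc n) ℕ.+ ν n
ν-suc n 2≤n = trans
  (length-filter-bijection topTwoEqual? incrementHead incrementHead-injective
    (nuclearPartitions-unique (suc n)) (nuclearPartitions-unique n)
    forward backward)
  -- `γ` filters once by a conjunction, while the bijection filters the nuclear partitions a second
  -- time.
  (cong (λ xs → length xs ℕ.+ ν n)
    (sym (filter-×-dec nuclear? topTwoEqual? (partitions (suc n)))))
  where
  n≢0 : ¬ 0 ≡ n
  n≢0 refl = contradiction 2≤n λ ()

  decreasing-incrementHead : ∀ {μ} → Linked _≥_ μ → Linked _≥_ (incrementHead μ)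
  decreasing-incrementHead []        = []
  decreasing-incrementHead [-]       = [-]
  decreasing-incrementHead (a≥b ∷ l) = ℕ.m≤n⇒m≤1+n a≥b ∷ l

  forward : ∀ {μ} → μ ∈ nuclearPartitions n →
            incrementHead μ ∈ nuclearPartitions (suc n) × ¬ TopTwoEqual (incrementHead μ)
  forward {μ} μ∈ with ∈-nuclearPartitions⁻ n μ∈
  forward {[]}    _ | isPartition _ _ s , _ = contradiction s n≢0
  forward {a ∷ μ} _ | isPartition d (a>0 ∷ p) s , nuc =
    ∈-nuclearPartitions⁺ (suc n)
      (isPartition (decreasing-incrementHead d) (s≤s z≤n ∷ p) (cong suc s)) nuclear
    , distinct d
    where
    nuclear : Nuclear (suc a ∷ μ)
    nuclear (here refl) = contradiction a>0 λ ()
    nuclear (there 1∈)  = nuc (there 1∈)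

    distinct : ∀ {μ} → Linked _≥_ (a ∷ μ) → ¬ TopTwoEqual (suc a ∷ μ)
    distinct (a≥b ∷ _) (topTwoEqual refl) = ℕ.<-irrefl refl a≥b

  -- Unequal top parts make the first inequality strict, which leaves room to lower the head by one.
  decreasing-decrementHead : ∀ {a μ} → Linked _≥_ (suc a ∷ μ) →
                             ¬ TopTwoEqual (suc a ∷ μ) → Linked _≥_ (a ∷ μ)
  decreasing-decrementHead [-]       _ = [-]
  decreasing-decrementHead (a≥b ∷ l) ¬eq =
    ℕ.≤-pred (ℕ.≤∧≢⇒< a≥b λ { refl → ¬eq (topTwoEqual refl) }) ∷ l

  -- Here the undecremented partition has head 2, so it is either (2), which is
  -- too small, or its second part is 1.
  head≢1 : ∀ {μ} → Linked _≥_ (1 ∷ μ) → All (0 <_) μ → sum (1 ∷ μ) ≡ n → ¬ Nuclear (2 ∷ μ)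
  head≢1 [-]       _         refl _   = ℕ.<-irrefl refl 2≤n
  head≢1 (1≥b ∷ _) (b>0 ∷ _) _    nuc = nuc (there (here (ℕ.≤-antisym b>0 1≥b)))

  backward : ∀ {μ} → μ ∈ nuclearPartitions (suc n) → ¬ TopTwoEqual μ →
             ∃ λ ρ → ρ ∈ nuclearPartitions n × μ ≡ incrementHead ρ
  backward {μ} μ∈ ¬eq with ∈-nuclearPartitions⁻ (suc n) μ∈
  backward {[]} _ _ | isPartition _ _ () , _
  backward {suc a ∷ μ} _ ¬eq | isPartition d (_ ∷ p) s , nuc =
    a ∷ μ , ∈-nuclearPartitions⁺ n
      -- If `a` were 0, the original head would be 1, against nuclearity.
      (isPartition d′ (ℕ.n≢0⇒n>0 (λ { refl → nuc (here refl) }) ∷ p) s′) nuclear , refl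
    where
    d′ = decreasing-decrementHead d ¬eq
    s′ = ℕ.suc-injective s

    nuclear : Nuclear (a ∷ μ)
    nuclear (here refl) = head≢1 d′ p s′ nuc
    nuclear (there 1∈)  = nuc (there 1∈)

-- A term appended to the list becomes the initial value of the right fold; this brings it out as a
-- last summand.
foldr-+-acc : ∀ x xs → foldr ℤ._+_ x xs ≡ foldr ℤ._+_ 0ℤ xs ℤ.+ x
foldr-+-acc x []       = sym (ℤ.+-identityˡ x)
foldr-+-acc x (y ∷ ys) =
  trans (cong (λ z → y ℤ.+ z) (foldr-+-acc x ys)) (sym (ℤ.+-assoc y _ x))

-- The bound keeps truncated subtraction exact: the number of terms grows by one, and the new index
-- `a + m` is `suc b`. The case `a = suc b` starts from an empty sum.
sumFromTo-suc : ∀ a b f → a ≤ suc b → sumFromTo a (suc b) f ≡ sumFromTo a b f ℤ.+ f (suc b)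
sumFromTo-suc a b f a≤1+b = begin
  Σ (map g (upTo (suc (suc b) ∸ a)))    ≡⟨ cong (λ k → Σ (map g (upTo k))) (ℕ.+-∸-assoc 1 a≤1+b) ⟩
  Σ (map g (upTo (suc m)))              ≡⟨ cong (λ xs → Σ (map g xs)) (upTo-∷ʳ m) ⟨
  Σ (map g (upTo m ∷ʳ m))               ≡⟨ cong Σ (map-++ g (upTo m) _) ⟩
  Σ (map g (upTo m) ∷ʳ g m)             ≡⟨ foldr-∷ʳ ℤ._+_ 0ℤ (g m) (map g (upTo m)) ⟩
  foldr ℤ._+_ (g m ℤ.+ 0ℤ) (map g (upTo m)) ≡⟨ foldr-+-acc (g m ℤ.+ 0ℤ) (map g (upTo m)) ⟩
  Σ (map g (upTo m)) ℤ.+ (g m ℤ.+ 0ℤ)   ≡⟨ cong (λ z → Σ (map g (upTo m)) ℤ.+ z) (ℤ.+-identityʳ (g m)) ⟩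
  Σ (map g (upTo m)) ℤ.+ g m            ≡⟨ cong (λ k → Σ (map g (upTo m)) ℤ.+ f k) (ℕ.m+[n∸m]≡n a≤1+b) ⟩
  Σ (map g (upTo m)) ℤ.+ f (suc b)      ∎
  where
  open ≡-Reasoning
  m = suc b ∸ a
  g = λ i → f (a ℕ.+ i)
  Σ = foldr ℤ._+_ 0ℤ

mainTheorem9 : (n : ℕ) → 2 ≤ n →
    + p n ≡ + n * + ν n - sumFromTo 3 n (λ k → (+ k - 1ℤ) * + γ k)
mainTheorem9 (suc zero) (s≤s ())
-- By evaluation: `p 2 = 2`, `ν 2 = 1`, and the sum from 3 to 2 is empty.
mainTheorem9 (suc (suc zero)) _ = refl
mainTheorem9 (suc n@(suc (suc _))) _ = begin
  + p (suc n)
    ≡⟨ cong +_ (p-suc n) ⟩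
  + ν (suc n) ℤ.+ + p n
    ≡⟨ cong₂ (λ v q → + v ℤ.+ q) ν-rec (mainTheorem9 n 2≤n) ⟩
  (+ γ (suc n) ℤ.+ + ν n) ℤ.+ (+ n * + ν n - S)
    -- The new summand has coefficient `(n + 1) - 1 = n`, so it cancels `n` of the `n + 1` copies of
    -- `γ (suc n)` in the product. `1ℤ ℤ.+ + n` computes to `+ suc n`, which lets the next step fold
    -- the recurrences back.
    ≡⟨ rearrange (+ n) (+ γ (suc n)) (+ ν n) S ⟩
  (1ℤ ℤ.+ + n) * (+ γ (suc n) ℤ.+ + ν n) - (S ℤ.+ ((1ℤ ℤ.+ + n) - 1ℤ) * + γ (suc n))
    ≡⟨ cong₂ (λ v T → + suc n * + v - T) ν-rec (sumFromTo-suc 3 n f (s≤s 2≤n)) ⟨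
  + suc n * + ν (suc n) - sumFromTo 3 (suc n) f
    ∎
  where
  open ≡-Reasoning
  f : ℕ → ℤ
  f k = (+ k - 1ℤ) * + γ k
  S = sumFromTo 3 n f
  2≤n : 2 ≤ n
  2≤n = s≤s (s≤s z≤n)
  ν-rec = ν-suc n 2≤n

  rearrange : ∀ x g v s → (g ℤ.+ v) ℤ.+ (x * v - s) ≡
              (1ℤ ℤ.+ x) * (g ℤ.+ v) - (s ℤ.+ ((1ℤ ℤ.+ x) - 1ℤ) * g)
  rearrange = solve-∀
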